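{- For Colored Bin Packing with items of arbitrary sizes in $[0,1]$ and at least three colors, there is no deterministic online algorithm with asymptotic competitive ratio less than $2.5$.
   Context: Colored Bin Packing: items arrive as a sequence; each item has a size in $[0,1]$ and a color from a finite set $C$. A packing places items into unit-capacity bins, items in a bin ordered by arrival; it is valid if each bin has total size at most $1$ and no two consecutive items in a bin share a color. $\mathrm{OPT}(L)$ is the minimum number of bins in a valid packing of $L$ without reordering. An online algorithm must irrevocably place each item into an existing bin (respecting validity) or a new bin upon its arrival, without knowledge of future items; $\mathrm{ALG}(L)$ is the number of bins it uses. It is asymptotically $r$-competitive if $\mathrm{ALG}(L)\le r\cdot\mathrm{OPT}(L)+o(\mathrm{OPT}(L))$ for all $L$; the asymptotic competitive ratio is the infimum of such $r$. -}

module Defs where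

open import Data.Nat as ℕ using (ℕ; zero; suc; _⊔_) renaming (_≤_ to _≤ℕ_; _<_ to _<ℕ_; _≟_ to _≟ℕ_)
open import Data.Integer using (+_)
open import Data.Rational using (ℚ; 0ℚ; 1ℚ; _≤_; _<_; _+_; _*_; _/_; ∣_∣)
open import Data.Fin using (Fin)
open import Data.List using (List; []; _∷_; _++_; [_]; map; filter; zip; length; foldr)
open import Data.List.Relation.Unary.All using (All)
open import Data.List.Relation.Unary.Linked using (Linked)
open import Data.Product using (Σ; ∃; _×_; proj₁; proj₂)
open import Data.Unit using (⊤)
open import Relation.Binary.PropositionalEquality using (_≡_; _≢_)

toℚ : ℕ → ℚ
toℚ n = + n / 1

record Item (k : ℕ) : Set where
  constructor item
  field
    size  : ℚ
    color : Fin k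
    size≥0 : 0ℚ ≤ size
    size≤1 : size ≤ 1ℚ
open Item public

-- A packing of a sequence is given by assigning each item (in arrival order)
-- a bin index; a placed sequence is a list of (item, bin-index) pairs.
Placed : ℕ → Set
Placed k = List (Item k × ℕ)

binContents : ∀ {k} → Placed k → ℕ → List (Item k)
binContents p b = map proj₁ (filter (λ q → proj₂ q ≟ℕ b) p)

sumSizes : ∀ {k} → List (Item k) → ℚ
sumSizes = foldr (λ i s → size i + s) 0ℚ

ValidBin : ∀ {k} → List (Item k) → Set
ValidBin is = (sumSizes is ≤ 1ℚ) × Linked _≢_ (map color is)

ValidPacking : ∀ {k} → Placed k → Set
ValidPacking p = ∀ b → ValidBin (binContents p b)

Packable : ∀ {k} → List (Item k) → ℕ → Set
Packable L m = Σ (List ℕ) λ as →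
  (length as ≡ length L) × All (_<ℕ m) as × ValidPacking (zip L as)

IsOPT : ∀ {k} → List (Item k) → ℕ → Set
IsOPT L m = Packable L m × (∀ m' → Packable L m' → m ≤ℕ m')

-- Deterministic online algorithm: given the items seen so far (arrival
-- order) and the current item, choose a bin index (an already opened bin,
-- or index = number of opened bins for a new bin).
OnlineAlg : ℕ → Set
OnlineAlg k = List (Item k) → Item k → ℕ

runFrom : ∀ {k} → OnlineAlg k → List (Item k) → List (Item k) → List ℕ
runFrom A pre [] = []
runFrom A pre (x ∷ xs) = A pre x ∷ runFrom A (pre ++ [ x ]) xs

run : ∀ {k} → OnlineAlg k → List (Item k) → List ℕ
run A L = runFrom A [] L

-- each decision is an opened bin or the next new bin; n = bins opened so far
OnlineLegal : ℕ → List ℕ → Set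
OnlineLegal n [] = ⊤
OnlineLegal n (d ∷ ds) = (d ≤ℕ n) × OnlineLegal (n ⊔ suc d) ds

binsOpened : ℕ → List ℕ → ℕ
binsOpened n [] = n
binsOpened n (d ∷ ds) = binsOpened (n ⊔ suc d) ds

ALG : ∀ {k} → OnlineAlg k → List (Item k) → ℕ
ALG A L = binsOpened 0 (run A L)

ValidAlg : ∀ {k} → OnlineAlg k → Set
ValidAlg {k} A = ∀ (L : List (Item k)) →
  OnlineLegal 0 (run A L) × ValidPacking (zip L (run A L))

LittleO : (ℕ → ℚ) → Set
LittleO f = ∀ ε → 0ℚ < ε → ∃ λ N → ∀ n → N ≤ℕ n → ∣ f n ∣ ≤ ε * toℚ n

AsymptoticallyCompetitive : ∀ {k} → OnlineAlg k → ℚ → Set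
AsymptoticallyCompetitive {k} A r = Σ (ℕ → ℚ) λ f → LittleO f ×
  (∀ (L : List (Item k)) m → IsOPT L m → toℚ (ALG A L) ≤ r * toℚ m + f m)

{-# OPTIONS --safe #-}
module Submission where

-- The adversary fixes n and plays in two parts, against an offline packing into n bins plus one
-- auxiliary bin per phase.
--
-- Part 1 (items of size zero) forces almost 3n/2 online bins with the same top color a, while n
-- offline bins have top color a.  In a phase, n items alternating between the other two colors b
-- and c arrive.  If n/2 of the online bins keep their top color, n further items of color a arrive,
-- and offline the alternating items have covered the n bins.  Otherwise many online bins have
-- moved to the more frequent of b and c, say b; then n items of color b arrive, and offline all
-- alternating items sit in an auxiliary bin.  The defect from 3n/2 is halved in each phase.
--
-- Part 2 adds n online bins with items that do not fit on top.  Tiny items of colors other than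
-- a arrive, their positive sizes chosen by bisection such that every item put on an untouched
-- online bin is larger than a threshold and every other item is smaller.  Offline, the former go
-- to an auxiliary bin and the latter on top of the n bins, so that huge items which just fit there
-- fit on no online bin touched by a tiny item; the untouched ones are blocked by their color a.

open import Defs
open import Data.Empty using (⊥; ⊥-elim)
open import Data.Fin as Fin using (Fin; fromℕ<)
open import Data.Fin.Properties using (injective⇒≤; fromℕ<-injective)
open import Data.Integer as ℤ using (+_; -[1+_])
import Data.Integer.Properties as ℤ
open import Data.List using (List; []; _∷_; _++_; _∷ʳ_; [_]; map; filter; zip; length;
  last; lookup; replicate; upTo)
open import Data.List.Membership.Propositional.Properties using (∈-lookup)
open import Data.List.Properties using (map-++; filter-++; filter-none; filter-accept; filter-reject;
  ++-assoc; ++-identityʳ; length-map; length-upTo; length-replicate; length-++)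
open import Data.List.Relation.Unary.All as All using (All; []; _∷_)
import Data.List.Relation.Unary.All.Properties as All
open import Data.List.Relation.Unary.AllPairs using ([]; _∷_)
open import Data.List.Relation.Unary.Linked using (Linked; []; [-]; _∷_)
import Data.List.Relation.Unary.Linked.Properties as Linked
open import Data.List.Relation.Unary.Unique.Propositional using (Unique)
import Data.List.Relation.Unary.Unique.Propositional.Properties as Unique
open import Data.Maybe using (Maybe; just; nothing)
open import Data.Maybe.Properties using (just-injective)
open import Data.Maybe.Relation.Binary.Connected using (Connected; just; nothing-just)
open import Data.Nat using (ℕ; zero; suc; _+_; _*_; _^_; _⊔_; _≟_; z≤n; s≤s)
  renaming (_≤_ to _≤ℕ_; _<_ to _<ℕ_)
open import Data.Nat.Induction using (<-rec)
import Data.Nat.Properties as ℕ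
open import Data.Nat.Tactic.RingSolver using (solve-∀)
open import Data.Product using (Σ; ∃; ∃₂; _×_; _,_; proj₁; proj₂)
open import Data.Rational as ℚ using (ℚ; 0ℚ; 1ℚ; ½; _/_; _<_; _≤_)
import Data.Rational.Properties as ℚ
import Data.Rational.Solver as ℚ
open import Data.Rational.Unnormalised as ℚᵘ using (mkℚᵘ)
import Data.Rational.Unnormalised.Properties as ℚᵘ
open import Data.Sum as Sum using (_⊎_; inj₁; inj₂)
open import Data.Unit using (⊤; tt)
open import Function using (_∘_; id)
open import Relation.Binary.PropositionalEquality using (_≡_; _≢_; refl; sym; trans; cong; cong₂; subst)
open import Relation.Nullary using (¬_; yes; no; contradiction)

-- Bins under appending one item.

module _ {X : Set} where

  last-∷ʳ : ∀ (xs : List X) x → last (xs ∷ʳ x) ≡ just x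
  last-∷ʳ []           x = refl
  last-∷ʳ (_ ∷ [])     x = refl
  last-∷ʳ (_ ∷ y ∷ ys) x = last-∷ʳ (y ∷ ys) x

  Linked-∷ʳ⁺ : ∀ {xs : List X} {y} → Linked _≢_ xs → last xs ≢ just y → Linked _≢_ (xs ∷ʳ y)
  Linked-∷ʳ⁺ {xs} {y} Rxs ≢y = Linked.++⁺ Rxs (connected (last xs) ≢y) [-]
    where
    connected : ∀ m → m ≢ just y → Connected _≢_ m (just y)
    connected nothing  _  = nothing-just
    connected (just _) ≢y = just (≢y ∘ cong just)

  Linked-∷ʳ⁻ : ∀ (xs : List X) {y} → Linked _≢_ (xs ∷ʳ y) → last xs ≢ just y
  Linked-∷ʳ⁻ (x ∷ [])         (Rxy ∷ _) eq = Rxy (just-injective eq)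
  Linked-∷ʳ⁻ (_ ∷ xs@(_ ∷ _)) (_ ∷ Rxs) eq = Linked-∷ʳ⁻ xs Rxs eq

module _ {k : ℕ} where

  -- An empty bin has top `nothing`, so `≢ just c` says exactly that color `c` may go on top, with
  -- no separate case for new bins.
  topColor : List (Item k) → Maybe (Fin k)
  topColor is = last (map color is)

  topColor-∷ʳ : ∀ is x → topColor (is ∷ʳ x) ≡ just (color x)
  topColor-∷ʳ is x = trans (cong last (map-++ color is [ x ])) (last-∷ʳ (map color is) (color x))

  sumSizes-∷ʳ : ∀ is (x : Item k) → sumSizes (is ∷ʳ x) ≡ sumSizes is ℚ.+ size x
  sumSizes-∷ʳ []       x = trans (ℚ.+-identityʳ (size x)) (sym (ℚ.+-identityˡ (size x)))
  sumSizes-∷ʳ (y ∷ is) x = trans (cong (size y ℚ.+_) (sumSizes-∷ʳ is x)) (sym (ℚ.+-assoc (size y) _ _))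

  sumSizes≥0 : ∀ (is : List (Item k)) → 0ℚ ≤ sumSizes is
  sumSizes≥0 []       = ℚ.≤-refl
  sumSizes≥0 (x ∷ is) = ℚ.+-mono-≤ (size≥0 x) (sumSizes≥0 is)

  sumSizes≤sumSizes-∷ʳ : ∀ is (x : Item k) → sumSizes is ≤ sumSizes (is ∷ʳ x)
  sumSizes≤sumSizes-∷ʳ is x = subst (sumSizes is ≤_) (sym (sumSizes-∷ʳ is x))
    (subst (_≤ sumSizes is ℚ.+ size x) (ℚ.+-identityʳ _) (ℚ.+-monoʳ-≤ (sumSizes is) (size≥0 x)))

  size≤sumSizes-∷ʳ : ∀ is (x : Item k) → size x ≤ sumSizes (is ∷ʳ x)
  size≤sumSizes-∷ʳ is x = subst (size x ≤_) (sym (sumSizes-∷ʳ is x))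
    (subst (_≤ sumSizes is ℚ.+ size x) (ℚ.+-identityˡ _) (ℚ.+-monoˡ-≤ (size x) (sumSizes≥0 is)))

  ValidBin-∷ʳ⁺ : ∀ {is} {x : Item k} → ValidBin is → sumSizes is ℚ.+ size x ≤ 1ℚ →
                 topColor is ≢ just (color x) → ValidBin (is ∷ʳ x)
  ValidBin-∷ʳ⁺ {is} {x} (_ , linked) fits ≢top =
    subst (_≤ 1ℚ) (sym (sumSizes-∷ʳ is x)) fits ,
    subst (Linked _≢_) (sym (map-++ color is [ x ])) (Linked-∷ʳ⁺ linked ≢top)

  ValidBin-∷ʳ⁻ : ∀ is {x : Item k} → ValidBin (is ∷ʳ x) →
                 sumSizes is ℚ.+ size x ≤ 1ℚ × topColor is ≢ just (color x)
  ValidBin-∷ʳ⁻ is {x} (fits , linked) =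
    subst (_≤ 1ℚ) (sumSizes-∷ʳ is x) fits ,
    Linked-∷ʳ⁻ (map color is) (subst (Linked _≢_) (map-++ color is [ x ]) linked)

  binContents-++ : ∀ (p q : Placed k) b → binContents (p ++ q) b ≡ binContents p b ++ binContents q b
  binContents-++ p q b = trans (cong (map proj₁) (filter-++ (λ q → proj₂ q ≟ b) p q))
    (map-++ proj₁ (filter (λ q → proj₂ q ≟ b) p) _)

  binContents-here : ∀ p (x : Item k) b → binContents (p ∷ʳ (x , b)) b ≡ binContents p b ∷ʳ x
  binContents-here p x b = trans (binContents-++ p [ x , b ] b)
    (cong (λ q → binContents p b ++ map proj₁ q) (filter-accept (λ q → proj₂ q ≟ b) {xs = []} refl))

  binContents-there : ∀ p (x : Item k) {b b′} → b ≢ b′ → binContents (p ∷ʳ (x , b)) b′ ≡ binContents p b′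
  binContents-there p x {b} {b′} b≢b′ =
    trans (binContents-++ p [ x , b ] b′) (trans
      (cong (λ q → binContents p b′ ++ map proj₁ q) (filter-reject (λ q → proj₂ q ≟ b′) {xs = []} b≢b′))
      (++-identityʳ _))

  -- An eliminator for an arbitrary predicate `Q`, so that the comparison of bin indices is made
  -- once, here.
  binContents-∷ʳ : ∀ (Q : List (Item k) → Set) p x b b′ →
                   (b ≡ b′ → Q (binContents p b ∷ʳ x)) → (b ≢ b′ → Q (binContents p b′)) →
                   Q (binContents (p ∷ʳ (x , b)) b′)
  binContents-∷ʳ Q p x b b′ here there with b ≟ b′
  ... | yes refl = subst Q (sym (binContents-here p x b)) (here refl)
  ... | no b≢b′  = subst Q (sym (binContents-there p x b≢b′)) (there b≢b′)

  binContents-≥ : ∀ {M b} (p : Placed k) → All (λ q → proj₂ q <ℕ M) p → M ≤ℕ b → binContents p b ≡ []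
  binContents-≥ {b = b} p bins M≤b =
    cong (map proj₁) (filter-none (λ q → proj₂ q ≟ b) (All.map (λ b<M → ℕ.<⇒≢ (ℕ.<-≤-trans b<M M≤b)) bins))

-- Pigeonhole and the number of opened bins.

lookup-injective : ∀ {X : Set} {xs : List X} → Unique xs → ∀ i j → lookup xs i ≡ lookup xs j → i ≡ j
lookup-injective (_  ∷ _)      Fin.zero    Fin.zero    _  = refl
lookup-injective (x∉ ∷ _)      Fin.zero    (Fin.suc j) eq = contradiction eq (All.lookup x∉ (∈-lookup j))
lookup-injective (x∉ ∷ _)      (Fin.suc i) Fin.zero    eq = contradiction (sym eq) (All.lookup x∉ (∈-lookup i))
lookup-injective (_  ∷ unique) (Fin.suc i) (Fin.suc j) eq = cong Fin.suc (lookup-injective unique i j eq)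

unique-bound : ∀ {M} (S : List ℕ) → Unique S → All (_<ℕ M) S → length S ≤ℕ M
unique-bound {M} S unique bounded = injective⇒≤ {f = index} λ {i} {j} eq →
  lookup-injective unique i j (fromℕ<-injective _ _ (below i) (below j) eq)
  where
  below : ∀ i → lookup S i <ℕ M
  below i = All.lookup bounded (∈-lookup {xs = S} i)
  index : Fin (length S) → Fin M
  index i = fromℕ< (below i)

binsOpened-≥ : ∀ n ds → n ≤ℕ binsOpened n ds
binsOpened-≥ n []       = ℕ.≤-refl
binsOpened-≥ n (d ∷ ds) = ℕ.≤-trans (ℕ.m≤m⊔n n (suc d)) (binsOpened-≥ (n ⊔ suc d) ds)

binsOpened-> : ∀ n ds → All (_<ℕ binsOpened n ds) ds
binsOpened-> n []       = []
binsOpened-> n (d ∷ ds) =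
  ℕ.≤-trans (ℕ.m≤n⊔m n (suc d)) (binsOpened-≥ (n ⊔ suc d) ds) ∷ binsOpened-> (n ⊔ suc d) ds

module _ {X Y : Set} {P : Y → Set} where

  zip-All₂ : ∀ (xs : List X) {ys} → All P ys → All (P ∘ proj₂) (zip xs ys)
  zip-All₂ []       _          = []
  zip-All₂ (_ ∷ _)  []         = []
  zip-All₂ (_ ∷ xs) (py ∷ pys) = py ∷ zip-All₂ xs pys

-- Counting online bins with a given property.

module Online {k : ℕ} (A : OnlineAlg k) (valid : ValidAlg A) where

  placed : List (Item k) → Placed k
  placed L = zip L (run A L)

  contents : List (Item k) → ℕ → List (Item k)
  contents L = binContents (placed L)

  placed-∷ʳ : ∀ L x → placed (L ∷ʳ x) ≡ placed L ∷ʳ (x , A L x)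
  placed-∷ʳ L x = go [] L
    where
    go : ∀ pre L → zip (L ∷ʳ x) (runFrom A pre (L ∷ʳ x)) ≡ zip L (runFrom A pre L) ∷ʳ (x , A (pre ++ L) x)
    go pre []      = cong (λ l → [ x , A l x ]) (sym (++-identityʳ pre))
    go pre (y ∷ L) = cong ((y , A pre y) ∷_) (trans (go (pre ++ [ y ]) L)
      (cong (λ l → zip L (runFrom A (pre ++ [ y ]) L) ∷ʳ (x , A l x)) (++-assoc pre [ y ] L)))

  contents-∷ʳ : ∀ (Q : List (Item k) → Set) L x b →
                (A L x ≡ b → Q (contents L (A L x) ∷ʳ x)) → (A L x ≢ b → Q (contents L b)) →
                Q (contents (L ∷ʳ x) b)
  contents-∷ʳ Q L x b here there =
    subst (λ p → Q (binContents p b)) (sym (placed-∷ʳ L x)) (binContents-∷ʳ Q (placed L) x (A L x) b here there)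

  validStep : ∀ L x → ValidBin (contents L (A L x) ∷ʳ x)
  validStep L x = subst ValidBin
    (trans (cong (λ p → binContents p (A L x)) (placed-∷ʳ L x)) (binContents-here (placed L) x (A L x)))
    (proj₂ (valid (L ∷ʳ x)) (A L x))

  -- The witnesses are explicit bin indices, so the same bins can be followed while further items
  -- arrive.
  record AtLeast (P : List (Item k) → Set) (L : List (Item k)) (N : ℕ) : Set where
    constructor distinctBins
    field
      bins   : List ℕ
      unique : Unique bins
      all    : All (P ∘ contents L) bins
      size≡  : length bins ≡ N

  transport : ∀ {P Q L L′ N} → (∀ b → P (contents L b) → Q (contents L′ b)) → AtLeast P L N → AtLeast Q L′ N
  transport f (distinctBins S unique all len) = distinctBins S unique (All.map (f _) all) len

  insert : ∀ {P L N} b → ¬ P (contents L b) → ∀ {Q L′} → Q (contents L′ b) →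
           (∀ b → P (contents L b) → Q (contents L′ b)) → AtLeast P L N → AtLeast Q L′ (suc N)
  insert b ¬P {Q} {L′} Qb f (distinctBins S unique all len) =
    distinctBins (b ∷ S) (All.map (λ { p refl → ¬P p }) all ∷ unique) (Qb ∷ All.map (f _) all) (cong suc len)

  -- An item changes only the bin that receives it, so it does not matter where the algorithm puts
  -- it.
  keep : ∀ {P N} L xs → All (λ x → ∀ is → P is → P (is ∷ʳ x)) xs → AtLeast P L N → AtLeast P (L ++ xs) N
  keep {P} {N} L []       []         many = subst (λ l → AtLeast P l N) (sym (++-identityʳ L)) many
  keep {P} {N} L (x ∷ xs) (px ∷ pxs) many = subst (λ l → AtLeast P l N) (++-assoc L [ x ] xs)
    (keep (L ∷ʳ x) xs pxs (transport (λ b p → contents-∷ʳ P L x b (λ { refl → px _ p }) (λ _ → p)) many))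

  -- Validity keeps each item out of the counted bins, so it lands in another bin, which then counts
  -- as well.
  flood : ∀ {P N} L xs →
          All (λ x → ∀ is → (ValidBin (is ∷ʳ x) → ¬ P is) × P (is ∷ʳ x)) xs →
          AtLeast P L N → AtLeast P (L ++ xs) (N + length xs)
  flood {P} {N} L []       []         many =
    subst (AtLeast P (L ++ [])) (sym (ℕ.+-identityʳ N)) (subst (λ l → AtLeast P l N) (sym (++-identityʳ L)) many)
  flood {P} {N} L (x ∷ xs) (px ∷ pxs) many =
    subst (λ l → AtLeast P l (N + suc (length xs))) (++-assoc L [ x ] xs)
      (subst (AtLeast P ((L ∷ʳ x) ++ xs)) (sym (ℕ.+-suc N (length xs)))
        (flood (L ∷ʳ x) xs pxs (insert (A L x) (proj₁ (px _) (validStep L x))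
          (contents-∷ʳ P L x (A L x) (λ _ → proj₂ (px _)) (λ ≢ → contradiction refl ≢))
          (λ b p → contents-∷ʳ P L x b (λ _ → proj₂ (px _)) (λ _ → p)) many)))

  split : ∀ {P Q L N} → AtLeast (λ is → P is ⊎ Q is) L N →
          ∃₂ λ M M′ → M + M′ ≡ N × AtLeast P L M × AtLeast Q L M′
  split {P} {Q} {L} (distinctBins S unique all refl) with partition S unique all
    where
    partition : ∀ S → Unique S → All (λ b → P (contents L b) ⊎ Q (contents L b)) S →
                ∃₂ λ S₁ S₂ → length S₁ + length S₂ ≡ length S ×
                  -- This clause replaces a sublist relation: with `R` as `b ≢_`, it passes the
                  -- freshness of `b` to both parts.
                  (∀ {R : ℕ → Set} → All R S → All R S₁ × All R S₂) ×
                  Unique S₁ × Unique S₂ × All (P ∘ contents L) S₁ × All (Q ∘ contents L) S₂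
    partition [] _ _ = [] , [] , refl , (λ _ → [] , []) , [] , [] , [] , []
    partition (b ∷ S) (≢b ∷ unique) (pq ∷ all) with partition S unique all | pq
    ... | S₁ , S₂ , len , sub , u₁ , u₂ , a₁ , a₂ | inj₁ p =
      b ∷ S₁ , S₂ , cong suc len , (λ { (r ∷ rs) → r ∷ proj₁ (sub rs) , proj₂ (sub rs) }) ,
      proj₁ (sub ≢b) ∷ u₁ , u₂ , p ∷ a₁ , a₂
    ... | S₁ , S₂ , len , sub , u₁ , u₂ , a₁ , a₂ | inj₂ q =
      S₁ , b ∷ S₂ , trans (ℕ.+-suc (length S₁) (length S₂)) (cong suc len) ,
      (λ { (r ∷ rs) → proj₁ (sub rs) , r ∷ proj₂ (sub rs) }) ,
      u₁ , proj₂ (sub ≢b) ∷ u₂ , a₁ , q ∷ a₂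
  ... | S₁ , S₂ , len , _ , u₁ , u₂ , a₁ , a₂ =
    length S₁ , length S₂ , len , distinctBins S₁ u₁ a₁ refl , distinctBins S₂ u₂ a₂ refl

  -- A bin with index `ALG A L` or more is empty, so the counted bins are distinct numbers below
  -- `ALG A L`.
  ≤ALG : ∀ {P L N} → (∀ {is} → P is → is ≢ []) → AtLeast P L N → N ≤ℕ ALG A L
  ≤ALG {L = L} nonempty (distinctBins S unique all refl) = unique-bound S unique (All.map opened all)
    where
    opened : ∀ {b} → _ → b <ℕ ALG A L
    opened {b} p with b ℕ.<? ALG A L
    ... | yes b<ALG = b<ALG
    ... | no b≮ALG  = contradiction
      (binContents-≥ (placed L) (zip-All₂ L (binsOpened-> 0 (run A L))) (ℕ.≮⇒≥ b≮ALG)) (nonempty p)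

-- Building offline packings.

zip-proj₁-proj₂ : ∀ {X Y : Set} (ps : List (X × Y)) → zip (map proj₁ ps) (map proj₂ ps) ≡ ps
zip-proj₁-proj₂ []       = refl
zip-proj₁-proj₂ (p ∷ ps) = cong (p ∷_) (zip-proj₁-proj₂ ps)

module _ {k : ℕ} where

  -- Items are stored together with their bins, so that packing one more item is an append. `M` only
  -- bounds the indices; bins may be empty.
  record Packing (L : List (Item k)) (M : ℕ) : Set where
    field
      pairs : Placed k
      items : map proj₁ pairs ≡ L
      bins  : All (λ q → proj₂ q <ℕ M) pairs
      valid : ValidPacking pairs
  open Packing

  inBin : ∀ {L M} → Packing L M → ℕ → List (Item k)
  inBin P = binContents (pairs P)

  toPackable : ∀ {L M} → Packing L M → Packable L M
  toPackable P with pairs P | items P | bins P | valid P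
  ... | ps | refl | bins | valid =
    map proj₂ ps , trans (length-map proj₂ ps) (sym (length-map proj₁ ps)) ,
    All.map⁺ bins , subst ValidPacking (sym (zip-proj₁-proj₂ ps)) valid

  emptyPacking : ∀ {M} → Packing [] M
  emptyPacking = record { pairs = [] ; items = refl ; bins = [] ; valid = λ _ → ℚ.nonNegative⁻¹ 1ℚ , [] }

  castItems : ∀ {L L′ M} → L ≡ L′ → Packing L M → Packing L′ M
  castItems eq P = record { pairs = pairs P ; items = trans (items P) eq ; bins = bins P ; valid = valid P }

  addBin : ∀ {L M} → Packing L M → Packing L (suc M)
  addBin P = record
    { pairs = pairs P ; items = items P ; bins = All.map ℕ.m≤n⇒m≤1+n (bins P) ; valid = valid P }

  inBin-fresh : ∀ {L M} (P : Packing L M) → inBin P M ≡ []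
  inBin-fresh P = binContents-≥ (pairs P) (bins P) ℕ.≤-refl

  put : ∀ {L M} (P : Packing L M) x {b} → b <ℕ M → ValidBin (inBin P b ∷ʳ x) →
        Σ (Packing (L ∷ʳ x) M) λ P′ →
          inBin P′ b ≡ inBin P b ∷ʳ x × (∀ {b′} → b ≢ b′ → inBin P′ b′ ≡ inBin P b′)
  put P x {b} b<M ok = record
    { pairs = pairs P ∷ʳ (x , b)
    ; items = trans (map-++ proj₁ (pairs P) _) (cong (_∷ʳ x) (items P))
    ; bins  = All.∷ʳ⁺ (bins P) b<M
    ; valid = λ b′ → binContents-∷ʳ ValidBin (pairs P) x b b′ (λ _ → ok) (λ _ → valid P b′)
    } , binContents-here (pairs P) x b , binContents-there (pairs P) x

  -- Each listed bin receives exactly one item, so `Q` need only hold before the layer. The last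
  -- component leaves all other bins available for later steps.
  layer : ∀ {Q R : List (Item k) → Set} {L M} xs bs → length xs ≡ length bs → Unique bs → All (_<ℕ M) bs →
          All (λ x → ∀ {is} → ValidBin is → Q is → ValidBin (is ∷ʳ x) × R (is ∷ʳ x)) xs →
          (P : Packing L M) → All (Q ∘ inBin P) bs →
          Σ (Packing (L ++ xs) M) λ P′ →
            All (R ∘ inBin P′) bs × (∀ b → All (b ≢_) bs → inBin P′ b ≡ inBin P b)
  layer {L = L} [] [] _ _ _ _ P [] = castItems (sym (++-identityʳ L)) P , [] , λ _ _ → refl
  layer {Q} {R} {L} (x ∷ xs) (b ∷ bs) len (b∉bs ∷ unique) (b<M ∷ bounded) (ok ∷ oks) P (q ∷ qs)
    with P₁ , here , there ← put P x b<M (proj₁ (ok (valid P b) q))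
    with P′ , rs , unchanged ← layer {Q} {R} xs bs (ℕ.suc-injective len) unique bounded oks P₁
           (All.zipWith (λ (≢ , q) → subst Q (sym (there ≢)) q) (b∉bs , qs)) =
    castItems (++-assoc L [ x ] xs) P′ ,
    subst R (sym (trans (unchanged b b∉bs) here)) (proj₂ (ok (valid P b) q)) ∷ rs ,
    λ { b′ (b′≢b ∷ b′∉bs) → trans (unchanged b′ b′∉bs) (there (b′≢b ∘ sym)) }

  zeroItem : Fin k → Item k
  zeroItem c = item 0ℚ c ℚ.≤-refl (ℚ.nonNegative⁻¹ 1ℚ)

  alternate : Fin k → Fin k → ℕ → List (Item k)
  alternate c d zero    = []
  alternate c d (suc n) = zeroItem c ∷ alternate d c n

  length-alternate : ∀ c d n → length (alternate c d n) ≡ n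
  length-alternate c d zero    = refl
  length-alternate c d (suc n) = cong suc (length-alternate d c n)

  alternate⁺ : ∀ {P : Item k → Set} {c d} n → P (zeroItem c) → P (zeroItem d) → All P (alternate c d n)
  alternate⁺ zero    pc pd = []
  alternate⁺ (suc n) pc pd = pc ∷ alternate⁺ n pd pc

  Weightless : List (Item k) → Set
  Weightless is = sumSizes is ≡ 0ℚ

  Weightless-∷ʳ : ∀ is c → Weightless is → Weightless (is ∷ʳ zeroItem c)
  Weightless-∷ʳ is c eq = trans (sumSizes-∷ʳ is (zeroItem c)) (trans (ℚ.+-identityʳ _) eq)

  ValidBin-zeroItem : ∀ {is c} → ValidBin is → topColor is ≢ just c → ValidBin (is ∷ʳ zeroItem c)
  ValidBin-zeroItem {is} v = ValidBin-∷ʳ⁺ v (subst (_≤ 1ℚ) (sym (ℚ.+-identityʳ (sumSizes is))) (proj₁ v))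

  -- Weightless items of alternating colors all fit into the single bin `e`.
  stack : ∀ {L M e c d} n → c ≢ d → e <ℕ M → (P : Packing L M) → topColor (inBin P e) ≢ just c →
          Σ (Packing (L ++ alternate c d n) M) λ P′ → ∀ b → b ≢ e → inBin P′ b ≡ inBin P b
  stack {L} zero _ _ P _ = castItems (sym (++-identityʳ L)) P , λ _ _ → refl
  stack {L} {e = e} {c} {d} (suc n) c≢d e<M P ≢top
    with P₁ , here , there ← put P (zeroItem c) e<M (ValidBin-zeroItem (valid P e) ≢top)
    with P′ , unchanged ← stack n (c≢d ∘ sym) e<M P₁ (λ top≡d → c≢d (just-injective
           (trans (sym (trans (cong topColor here) (topColor-∷ʳ (inBin P e) (zeroItem c)))) top≡d))) =
    castItems (++-assoc L [ zeroItem c ] _) P′ ,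
    λ b b≢e → trans (unchanged b b≢e) (there (b≢e ∘ sym))

open Packing

-- Top colors of the first `n` offline bins.

upTo-bounded : ∀ j n → All (_<ℕ j + n) (upTo n)
upTo-bounded j n = All.applyUpTo⁺₁ id n (λ i<n → ℕ.<-≤-trans i<n (ℕ.m≤n+m n j))

module _ {k : ℕ} where

  Top : Fin k → List (Item k) → Set
  Top a is = topColor is ≡ just a

  Top-disjoint : ∀ {a b} is → a ≢ b → Top a is → topColor is ≢ just b
  Top-disjoint _ a≢b top≡a top≡b = a≢b (just-injective (trans (sym top≡a) top≡b))

  NotTop : Fin k → List (Item k) → Set
  NotTop a is = topColor is ≢ just a

  WeightlessTop WeightlessNot : Fin k → List (Item k) → Set
  WeightlessTop a is = Weightless is × Top a is
  WeightlessNot a is = Weightless is × NotTop a is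

  cover : ∀ {Q R : List (Item k) → Set} {L} j n xs → length xs ≡ n →
          All (λ x → ∀ {is} → ValidBin is → Q is → ValidBin (is ∷ʳ x) × R (is ∷ʳ x)) xs →
          (P : Packing L (j + n)) → All (Q ∘ inBin P) (upTo n) →
          Σ (Packing (L ++ xs) (j + n)) λ P′ → All (R ∘ inBin P′) (upTo n)
  cover {Q} {R} j n xs len oks P qs
    with P′ , rs , _ ← layer {Q = Q} {R = R} xs (upTo n) (trans len (sym (length-upTo n)))
                         (Unique.upTo⁺ n) (upTo-bounded j n) oks P qs = P′ , rs

  paint : ∀ {L} j n a (P : Packing L (j + n)) →
          All (WeightlessNot a ∘ inBin P) (upTo n) →
          Σ (Packing (L ++ replicate n (zeroItem a)) (j + n)) λ P′ →
            All (WeightlessTop a ∘ inBin P′) (upTo n)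
  paint j n a = cover {Q = WeightlessNot a} {R = WeightlessTop a} j n
    (replicate n (zeroItem a)) (length-replicate n)
    (All.replicate⁺ n λ {is} v (w , ≢a) → ValidBin-zeroItem v ≢a , Weightless-∷ʳ is a w , topColor-∷ʳ is (zeroItem a))

-- Part 1: the phases with weightless items.

majority-keeps : ∀ n m D → n ≤ℕ 2 * m → 3 * n ≤ℕ 2 * (m + n) + D
majority-keeps n m D n≤2m = begin
  3 * n            ≡⟨ regroup n ⟩
  n + 2 * n        ≤⟨ ℕ.+-monoˡ-≤ (2 * n) n≤2m ⟩
  2 * m + 2 * n    ≡⟨ ℕ.*-distribˡ-+ 2 m n ⟨
  2 * (m + n)      ≤⟨ ℕ.m≤m+n _ D ⟩
  2 * (m + n) + D  ∎
  where
  open ℕ.≤-Reasoning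
  regroup : ∀ n → 3 * n ≡ n + 2 * n
  regroup = solve-∀

-- At most n/2 bins stay, so p + q is at least n - D and the larger share p at least (n - D)/2. With
-- n more bins the count misses 3n/2 by at most D/2, where it missed by D before.
majority-leaves : ∀ n m p q D → 3 * n ≤ℕ 2 * (m + (p + q)) + 2 * D → 2 * m ≤ℕ n → q ≤ℕ p →
                  3 * n ≤ℕ 2 * (p + n) + D
majority-leaves n m p q D bound 2m≤n q≤p = ℕ.*-cancelˡ-≤ 2 (begin
  2 * (3 * n)                              ≡⟨ e₁ n ⟩
  3 * n + 3 * n                            ≤⟨ ℕ.+-monoˡ-≤ (3 * n) bound ⟩
  2 * (m + (p + q)) + 2 * D + 3 * n        ≤⟨ ℕ.+-monoˡ-≤ (3 * n) (ℕ.+-monoˡ-≤ (2 * D)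
                                                (ℕ.*-monoʳ-≤ 2 (ℕ.+-monoʳ-≤ m (ℕ.+-monoʳ-≤ p q≤p)))) ⟩
  2 * (m + (p + p)) + 2 * D + 3 * n        ≡⟨ e₂ n m p D ⟩
  2 * m + (4 * p + 2 * D + 3 * n)          ≤⟨ ℕ.+-monoˡ-≤ (4 * p + 2 * D + 3 * n) 2m≤n ⟩
  n + (4 * p + 2 * D + 3 * n)              ≡⟨ e₃ n p D ⟩
  2 * (2 * (p + n) + D)                    ∎)
  where
  open ℕ.≤-Reasoning
  e₁ : ∀ n → 2 * (3 * n) ≡ 3 * n + 3 * n
  e₁ = solve-∀
  e₂ : ∀ n m p D → 2 * (m + (p + p)) + 2 * D + 3 * n ≡ 2 * m + (4 * p + 2 * D + 3 * n)
  e₂ = solve-∀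
  e₃ : ∀ n p D → n + (4 * p + 2 * D + 3 * n) ≡ 2 * (2 * (p + n) + D)
  e₃ = solve-∀

module Phases {k : ℕ} (A : OnlineAlg k) (valid : ValidAlg A) (n : ℕ) where

  open Online A valid

  -- Up to the defect D, the algorithm has 3n/2 bins with top color a, whereas n of the
  -- j + n bins of an offline packing have top color a; everything so far has size zero.
  record Stage (j D : ℕ) : Set where
    field
      L       : List (Item k)
      a b c   : Fin k
      a≢b     : a ≢ b
      a≢c     : a ≢ c
      b≢c     : b ≢ c
      N       : ℕ
      online  : AtLeast (Top a) L N
      bound   : 3 * n ≤ℕ 2 * N + D
      offline : Packing L (j + n)
      tops    : All (WeightlessTop a ∘ inBin offline) (upTo n)

  floodTop : ∀ {L N} a → AtLeast (Top a) L N → AtLeast (Top a) (L ++ replicate n (zeroItem a)) (N + n)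
  floodTop {L} {N} a many = subst (λ m → AtLeast (Top a) (L ++ replicate n (zeroItem a)) (N + m)) (length-replicate n)
    (flood L (replicate n (zeroItem a))
      (All.replicate⁺ n (λ is → (λ v → proj₂ (ValidBin-∷ʳ⁻ is v)) , topColor-∷ʳ is (zeroItem a))) many)

  start : ∀ {a b c} → a ≢ b → a ≢ c → b ≢ c → Stage 0 n
  start {a} {b} {c} a≢b a≢c b≢c
    with P , tops ← paint 0 n a emptyPacking (All.universal (λ _ → refl , λ ()) (upTo n)) = record
    { L = replicate n (zeroItem a) ; a = a ; b = b ; c = c ; a≢b = a≢b ; a≢c = a≢c ; b≢c = b≢c ; N = n
    ; online = floodTop a (distinctBins [] [] [] refl) ; bound = ℕ.≤-reflexive (lemma n)
    ; offline = P ; tops = tops }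
    where
    lemma : ∀ n → 3 * n ≡ 2 * n + n
    lemma = solve-∀

  module _ {j D : ℕ} (S : Stage j (2 * D)) where
    open Stage S

    probe : List (Item k)
    probe = alternate b c n

    probed : AtLeast (λ is → Top a is ⊎ Top b is ⊎ Top c is) (L ++ probe) N
    probed = keep L probe
      (alternate⁺ n (λ is _ → inj₂ (inj₁ (topColor-∷ʳ is (zeroItem b)))) (λ is _ → inj₂ (inj₂ (topColor-∷ʳ is (zeroItem c)))))
      (transport (λ _ → inj₁) online)

    -- Offline, the probe gives each of the `n` bins one item of color `b` or `c`, which makes room
    -- for color `a` again. The added bin stays empty and only matches the count in `switch`.
    refill : ∀ {N′} → 3 * n ≤ℕ 2 * (N′ + n) + D → AtLeast (Top a) (L ++ probe) N′ → Stage (suc j) D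
    refill {N′} bound′ many
      with P₁ , tops₁ ← cover {Q = WeightlessTop a} {R = WeightlessNot a} (suc j) n probe (length-alternate b c n)
             (alternate⁺ n
               (λ {is} v (w , ≡a) → ValidBin-zeroItem v (Top-disjoint is a≢b ≡a) , Weightless-∷ʳ is b w ,
                 Top-disjoint (is ∷ʳ zeroItem b) (a≢b ∘ sym) (topColor-∷ʳ is (zeroItem b)))
               (λ {is} v (w , ≡a) → ValidBin-zeroItem v (Top-disjoint is a≢c ≡a) , Weightless-∷ʳ is c w ,
                 Top-disjoint (is ∷ʳ zeroItem c) (a≢c ∘ sym) (topColor-∷ʳ is (zeroItem c))))
             (addBin offline) tops
      with P₂ , tops₂ ← paint (suc j) n a P₁ tops₁ = record
      { L = (L ++ probe) ++ replicate n (zeroItem a) ; a = a ; b = b ; c = c ; a≢b = a≢b ; a≢c = a≢c ; b≢c = b≢c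
      ; N = N′ + n ; online = floodTop a many ; bound = bound′ ; offline = P₂ ; tops = tops₂ }

    -- With the whole probe in the added bin, the `n` bins still show `a` and all accept `b′`, which
    -- takes over the role of `a`.
    switch : ∀ {N′} b′ c′ → a ≢ b′ → a ≢ c′ → b′ ≢ c′ → 3 * n ≤ℕ 2 * (N′ + n) + D →
             AtLeast (Top b′) (L ++ probe) N′ → Stage (suc j) D
    switch {N′} b′ c′ a≢b′ a≢c′ b′≢c′ bound′ many
      with P₁ , unchanged ← stack n b≢c (ℕ.n<1+n (j + n)) (addBin offline)
             (subst (NotTop b) (sym (inBin-fresh offline)) (λ ()))
      with P₂ , tops₂ ← paint (suc j) n b′ P₁ (All.zipWith
             (λ {i} (i<M , w , ≡a) → subst (WeightlessNot b′) (sym (unchanged i (ℕ.<⇒≢ i<M)))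
               (w , Top-disjoint (inBin offline i) a≢b′ ≡a))
             (upTo-bounded j n , tops)) = record
      { L = (L ++ probe) ++ replicate n (zeroItem b′) ; a = b′ ; b = a ; c = c′ ; a≢b = a≢b′ ∘ sym ; a≢c = b′≢c′
      ; b≢c = a≢c′ ; N = N′ + n ; online = floodTop b′ many ; bound = bound′ ; offline = P₂ ; tops = tops₂ }

    phase : Stage (suc j) D
    phase with m , _ , refl , stay , left ← split probed
          with p , q , refl , toB , toC ← split left
          with ℕ.≤-total n (2 * m)
    ... | inj₁ n≤2m = refill (majority-keeps n m D n≤2m) stay
    ... | inj₂ 2m≤n with ℕ.≤-total q p
    ...   | inj₁ q≤p = switch b c a≢b a≢c b≢c (majority-leaves n m p q D bound 2m≤n q≤p) toB
    ...   | inj₂ p≤q = switch c b a≢c a≢b (b≢c ∘ sym)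
      (majority-leaves n m q p D (subst (λ r → 3 * n ≤ℕ 2 * (m + r) + 2 * D) (ℕ.+-comm p q) bound) 2m≤n p≤q) toC

  phases : ∀ t {j s} → Stage j (2 ^ t * s) → Stage (t + j) s
  phases zero    {j} {s} S = subst (Stage j) (ℕ.*-identityˡ s) S
  phases (suc t) {j} {s} S = subst (λ i → Stage i s) (ℕ.+-suc t j)
    (phases t (phase {j} {2 ^ t * s} (subst (Stage j) (ℕ.*-assoc 2 (2 ^ t) s) S)))

-- Rational estimates for item sizes.

<⇒≱ : ∀ {p q} → p < q → ¬ q ≤ p
<⇒≱ p<q q≤p = ℚ.<-irrefl refl (ℚ.<-≤-trans p<q q≤p)

½≤1 : ½ ≤ 1ℚ
½≤1 = ℚ.*≤* (ℤ.+≤+ (s≤s z≤n))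

-- Recursion on the count lets one of `suc r` reserved shares split off by computation.
_·_ : ℕ → ℚ → ℚ
zero  · h = 0ℚ
suc r · h = h ℚ.+ r · h

·-mono-≤ : ∀ r {h h′} → h ≤ h′ → r · h ≤ r · h′
·-mono-≤ zero    h≤h′ = ℚ.≤-refl
·-mono-≤ (suc r) h≤h′ = ℚ.+-mono-≤ h≤h′ (·-mono-≤ r h≤h′)

0≤· : ∀ r {h} → 0ℚ ≤ h → 0ℚ ≤ r · h
0≤· zero    0≤h = ℚ.≤-refl
0≤· (suc r) 0≤h = ℚ.+-mono-≤ 0≤h (0≤· r 0≤h)

½+½ : ∀ ε → ½ ℚ.* ε ℚ.+ ½ ℚ.* ε ≡ ε
½+½ ε = trans (sym (ℚ.*-distribʳ-+ ε ½ ½)) (ℚ.*-identityˡ ε)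

½-positive : ∀ {ε} → 0ℚ < ε → 0ℚ < ½ ℚ.* ε
½-positive {ε} 0<ε = subst (_< ½ ℚ.* ε) (ℚ.*-zeroʳ ½) (ℚ.*-monoʳ-<-pos ½ 0<ε)

p≤q+p : ∀ {p q} → 0ℚ ≤ q → p ≤ q ℚ.+ p
p≤q+p {p} {q} 0≤q = subst (_≤ q ℚ.+ p) (ℚ.+-identityˡ p) (ℚ.+-monoˡ-≤ p 0≤q)

p≤p+q : ∀ {p q} → 0ℚ ≤ q → p ≤ p ℚ.+ q
p≤p+q {p} {q} 0≤q = subst (_≤ p ℚ.+ q) (ℚ.+-identityʳ p) (ℚ.+-monoʳ-≤ p 0≤q)

-- Each unit of `K` halves the allowance: one half pays for a copy of `h`, the other for the
-- remaining copies.
fraction : ∀ K {ε} → 0ℚ < ε → ∃ λ h → 0ℚ < h × h ≤ ε × K · h ≤ ε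
fraction zero    {ε} 0<ε = ε , 0<ε , ℚ.≤-refl , ℚ.<⇒≤ 0<ε
fraction (suc K) {ε} 0<ε with h , 0<h , h≤ , K·h≤ ← fraction K (½-positive 0<ε) =
  h , 0<h , ℚ.≤-trans h≤ half≤ , subst (h ℚ.+ K · h ≤_) (½+½ ε) (ℚ.+-mono-≤ h≤ K·h≤)
  where
  half≤ : ½ ℚ.* ε ≤ ε
  half≤ = subst (½ ℚ.* ε ≤_) (½+½ ε) (p≤q+p (ℚ.<⇒≤ (½-positive 0<ε)))

p+[1-p]≡1 : ∀ p → p ℚ.+ (1ℚ ℚ.- p) ≡ 1ℚ
p+[1-p]≡1 p = trans (ℚ.+-comm p (1ℚ ℚ.- p)) (trans (ℚ.+-assoc 1ℚ (ℚ.- p) p)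
  (trans (cong (1ℚ ℚ.+_) (ℚ.+-inverseˡ p)) (ℚ.+-identityʳ 1ℚ)))

-- Part 2: the bisection game with tiny and huge items.

module _ {k : ℕ} where

  Heavy : ℚ → List (Item k) → Set
  Heavy h is = h ≤ sumSizes is

  Heavy-∷ʳ : ∀ {h} is x → Heavy h is → Heavy h (is ∷ʳ x)
  Heavy-∷ʳ is x heavy = ℚ.≤-trans heavy (sumSizes≤sumSizes-∷ʳ is x)

  Light : ℚ → Fin k → List (Item k) → Set
  Light h a is = sumSizes is ≤ h × NotTop a is

module Endgame {k : ℕ} (A : OnlineAlg k) (valid : ValidAlg A) (m n K : ℕ) (a : Fin k) where

  open Online A valid

  Outcome : Set
  Outcome = Σ (List (Item k)) λ L → Packing L (suc m) × K + n ≤ℕ ALG A L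

  -- An item is called large if the algorithm puts it into a bin of level less than hi, and small
  -- otherwise; hi and lo are the sizes of the last large and of the last small item. Offline,
  -- the large items go to bin m and the small ones to distinct bins, which thereby move from U to V.
  record Game (r : ℕ) (U : List ℕ) : Set where
    field
      L           : List (Item k)
      lo hi       : ℚ
      0≤lo        : 0ℚ ≤ lo
      lo<hi       : lo < hi
      hi≤½        : hi ≤ ½
      next other  : Fin k
      a≢next      : a ≢ next
      a≢other     : a ≢ other
      next≢other  : next ≢ other
      l           : ℕ
      l+r≡K       : l + r ≡ K
      heavy       : AtLeast (Heavy hi) L l
      blocked     : AtLeast (λ is → Top a is ⊎ Heavy hi is) L K
      V           : List ℕ
      sizes       : length V + length U ≡ n
      uniqueU     : Unique U
      uniqueV     : Unique V
      disjoint    : All (λ u → All (u ≢_) V) U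
      U<m         : All (_<ℕ m) U
      V<m         : All (_<ℕ m) V
      offline     : Packing L (suc m)
      inU         : All (WeightlessTop a ∘ inBin offline) U
      inV         : All (Light lo a ∘ inBin offline) V
      stackTop    : NotTop next (inBin offline m)
      stackLevel  : sumSizes (inBin offline m) ℚ.+ r · hi ≤ 1ℚ

  module _ {r : ℕ} {U : List ℕ} (G : Game r U) where
    open Game G

    lo≤½ : lo ≤ ½
    lo≤½ = ℚ.<⇒≤ (ℚ.<-≤-trans lo<hi hi≤½)

    hi≤1-lo : hi ≤ 1ℚ ℚ.- lo
    hi≤1-lo = ℚ.≤-trans hi≤½ (ℚ.+-monoʳ-≤ 1ℚ (ℚ.neg-antimono-≤ lo≤½))

    0≤1-lo : 0ℚ ≤ 1ℚ ℚ.- lo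
    0≤1-lo = ℚ.≤-trans 0≤lo (ℚ.≤-trans (ℚ.<⇒≤ lo<hi) hi≤1-lo)

    -- The size `1 - lo` fills a bin of level `lo` exactly and overflows any bin of level at least
    -- `hi`, as `lo < hi`.
    huge : Fin k → Item k
    huge c = item (1ℚ ℚ.- lo) c 0≤1-lo (subst (1ℚ ℚ.- lo ≤_) (p+[1-p]≡1 lo) (p≤q+p 0≤lo))

    huge-fits : ∀ {is c} → ValidBin is → sumSizes is ≤ lo → NotTop c is → ValidBin (is ∷ʳ huge c)
    huge-fits {is} v ≤lo ≢c =
      ValidBin-∷ʳ⁺ v (subst (sumSizes is ℚ.+ (1ℚ ℚ.- lo) ≤_) (p+[1-p]≡1 lo) (ℚ.+-monoˡ-≤ (1ℚ ℚ.- lo) ≤lo)) ≢c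

    huge-rejected : ∀ {is c} → ValidBin (is ∷ʳ huge c) → ¬ Heavy hi is
    huge-rejected {is} v heavy = <⇒≱
      (subst (_< sumSizes is ℚ.+ (1ℚ ℚ.- lo)) (p+[1-p]≡1 lo) (ℚ.+-monoˡ-< (1ℚ ℚ.- lo) (ℚ.<-≤-trans lo<hi heavy)))
      (proj₁ (ValidBin-∷ʳ⁻ is v))

    -- Since `lo` and `hi` are at most one half, a huge item makes its bin heavy, so that no second
    -- one fits.
    huge-heavy : ∀ is c → Heavy hi (is ∷ʳ huge c)
    huge-heavy is c = ℚ.≤-trans hi≤1-lo (size≤sumSizes-∷ʳ is (huge c))

    -- The bins of `V` no longer show `a` and can take it; the bins of `U` still show `a` and need
    -- another color.
    finale : List (Item k)
    finale = replicate (length V) (huge a) ++ replicate (length U) (huge next)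

    length-finale : length finale ≡ n
    length-finale = trans (length-++ (replicate (length V) (huge a)))
      (trans (cong₂ _+_ (length-replicate (length V)) (length-replicate (length U))) sizes)

    finalePacking : Packing (L ++ finale) (suc m)
    finalePacking with P₁ , _ , unchanged ← layer {Q = Light lo a} {R = λ _ → ⊤}
                         (replicate (length V) (huge a)) V (length-replicate (length V)) uniqueV
                         (All.map ℕ.m<n⇒m<1+n V<m)
                         (All.replicate⁺ (length V) λ v (≤lo , ≢a) → huge-fits {c = a} v ≤lo ≢a , tt)
                         offline inV
                  with P₂ , _ ← layer {Q = WeightlessTop a} {R = λ _ → ⊤}
                         (replicate (length U) (huge next)) U (length-replicate (length U)) uniqueU
                         (All.map ℕ.m<n⇒m<1+n U<m)
                         (All.replicate⁺ (length U) λ {is} v (w , ≡a) →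
                           huge-fits {c = next} v (subst (_≤ lo) (sym w) 0≤lo) (Top-disjoint is a≢next ≡a) , tt)
                         P₁ (All.zipWith (λ {u} (u∉V , t) → subst (WeightlessTop a) (sym (unchanged u u∉V)) t)
                              (disjoint , inU)) =
      castItems (++-assoc L (replicate (length V) (huge a)) _) P₂

    finish : ∀ {P} → (∀ {is} → P is → is ≢ []) →
             All (λ x → ∀ is → (ValidBin (is ∷ʳ x) → ¬ P is) × P (is ∷ʳ x)) finale →
             AtLeast P L K → Outcome
    finish {P} nonempty floods many = L ++ finale , finalePacking ,
      ≤ALG nonempty (subst (λ i → AtLeast P (L ++ finale) (K + i)) length-finale (flood L finale floods many))

    Heavy-nonempty : ∀ {is : List (Item k)} → Heavy hi is → is ≢ []
    Heavy-nonempty {[]} heavy refl = <⇒≱ (ℚ.≤-<-trans 0≤lo lo<hi) heavy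

    huge-floods-Heavy : ∀ c is → (ValidBin (is ∷ʳ huge c) → ¬ Heavy hi is) × Heavy hi (is ∷ʳ huge c)
    huge-floods-Heavy c is = huge-rejected , huge-heavy is c

  module _ {r : ℕ} {u : ℕ} {U : List ℕ} (G : Game (suc r) (u ∷ U)) {s : ℚ}
           (lo<s : Game.lo G < s) (s<hi : s < Game.hi G) where
    open Game G

    0≤s : 0ℚ ≤ s
    0≤s = ℚ.≤-trans 0≤lo (ℚ.<⇒≤ lo<s)

    s≤½ : s ≤ ½
    s≤½ = ℚ.≤-trans (ℚ.<⇒≤ s<hi) hi≤½

    s≤1 : s ≤ 1ℚ
    s≤1 = ℚ.≤-trans s≤½ ½≤1

    trial : Item k
    trial = item s next 0≤s s≤1

    -- The receiving online bin was already heavy, so no online count changes. Offline the trial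
    -- covers color `a` of the weightless bin `u`, whose level becomes `s`, the new `lo`.
    small : Heavy hi (contents L (A L trial)) → Game (suc r) U
    small placedHeavy
      with u∉U ∷ uniqueU′ ← uniqueU | u∉V ∷ disjoint′ ← disjoint | u<m ∷ U<m′ ← U<m | (w , ≡a) ∷ inU′ ← inU
      with level ← trans (cong (ℚ._+ s) w) (ℚ.+-identityˡ s)
      with P′ , here , there ← put offline trial (ℕ.m<n⇒m<1+n u<m)
             (ValidBin-∷ʳ⁺ (Packing.valid offline u) (subst (_≤ 1ℚ) (sym level) s≤1)
               (Top-disjoint (inBin offline u) a≢next ≡a)) = record
      { L = L ∷ʳ trial ; lo = s ; hi = hi ; 0≤lo = 0≤s ; lo<hi = s<hi ; hi≤½ = hi≤½
      ; next = next ; other = other ; a≢next = a≢next ; a≢other = a≢other ; next≢other = next≢other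
      ; l = l ; l+r≡K = l+r≡K
      ; heavy = transport (λ b p → contents-∷ʳ (Heavy hi) L trial b
          (λ _ → Heavy-∷ʳ (contents L (A L trial)) trial placedHeavy) (λ _ → p)) heavy
      ; blocked = transport (λ b p → contents-∷ʳ (λ is → Top a is ⊎ Heavy hi is) L trial b
          (λ _ → inj₂ (Heavy-∷ʳ (contents L (A L trial)) trial placedHeavy)) (λ _ → p)) blocked
      ; V = u ∷ V ; sizes = trans (sym (ℕ.+-suc (length V) (length U))) sizes
      ; uniqueU = uniqueU′ ; uniqueV = u∉V ∷ uniqueV
      ; disjoint = All.zipWith (λ (u≢ , ∉V) → (u≢ ∘ sym) ∷ ∉V) (u∉U , disjoint′)
      ; U<m = U<m′ ; V<m = u<m ∷ V<m
      ; offline = P′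
      ; inU = All.zipWith (λ (u≢ , t) → subst (WeightlessTop a) (sym (there u≢)) t) (u∉U , inU′)
      ; inV = subst (Light s a) (sym here)
                (ℚ.≤-reflexive (trans (sumSizes-∷ʳ (inBin offline u) trial) level) ,
                 Top-disjoint (inBin offline u ∷ʳ trial) (a≢next ∘ sym) (topColor-∷ʳ (inBin offline u) trial))
              ∷ All.zipWith (λ (u≢ , ≤lo , ≢a) → subst (Light s a) (sym (there u≢))
                  (ℚ.≤-trans ≤lo (ℚ.<⇒≤ lo<s) , ≢a)) (u∉V , inV)
      ; stackTop = subst (NotTop next) (sym (there (ℕ.<⇒≢ u<m))) stackTop
      ; stackLevel = subst (λ is → sumSizes is ℚ.+ suc r · hi ≤ 1ℚ) (sym (there (ℕ.<⇒≢ u<m))) stackLevel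
      }

    -- Lowering `hi` to `s` makes the receiving online bin heavy. Offline the trial goes on bin `m`,
    -- so `next` and `other` swap to keep the colors there alternating.
    large : ¬ Heavy hi (contents L (A L trial)) → Game r (u ∷ U)
    large placedLight
      with trialHeavy ← size≤sumSizes-∷ʳ (contents L (A L trial)) trial
      -- One of the `suc r` shares of size `hi` pays for the trial; the others shrink to `s`.
      with level ← subst (_≤ 1ℚ) (sym (ℚ.+-assoc (sumSizes (inBin offline m)) s (r · s)))
             (ℚ.≤-trans (ℚ.+-monoʳ-≤ (sumSizes (inBin offline m)) (·-mono-≤ (suc r) (ℚ.<⇒≤ s<hi))) stackLevel)
      with P′ , here , there ← put offline trial (ℕ.n<1+n m)
             (ValidBin-∷ʳ⁺ (Packing.valid offline m) (ℚ.≤-trans (p≤p+q (0≤· r 0≤s)) level) stackTop) = record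
      { L = L ∷ʳ trial ; lo = lo ; hi = s ; 0≤lo = 0≤lo ; lo<hi = lo<s ; hi≤½ = s≤½
      ; next = other ; other = next ; a≢next = a≢other ; a≢other = a≢next ; next≢other = next≢other ∘ sym
      ; l = suc l ; l+r≡K = trans (sym (ℕ.+-suc l r)) l+r≡K
      ; heavy = insert (A L trial) placedLight
          (contents-∷ʳ (Heavy s) L trial (A L trial) (λ _ → trialHeavy) (λ ≢ → contradiction refl ≢))
          (λ b p → contents-∷ʳ (Heavy s) L trial b (λ _ → trialHeavy) (λ _ → ℚ.≤-trans (ℚ.<⇒≤ s<hi) p)) heavy
      -- A counted bin may lose its top color `a` to the trial, but is then heavy.
      ; blocked = transport (λ b p → contents-∷ʳ (λ is → Top a is ⊎ Heavy s is) L trial b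
          (λ _ → inj₂ trialHeavy) (λ _ → Sum.map₂ (ℚ.≤-trans (ℚ.<⇒≤ s<hi)) p)) blocked
      ; V = V ; sizes = sizes ; uniqueU = uniqueU ; uniqueV = uniqueV ; disjoint = disjoint
      ; U<m = U<m ; V<m = V<m
      ; offline = P′
      ; inU = All.zipWith (λ (b<m , t) → subst (WeightlessTop a) (sym (there (ℕ.<⇒≢ b<m ∘ sym))) t) (U<m , inU)
      ; inV = All.zipWith (λ (b<m , t) → subst (Light lo a) (sym (there (ℕ.<⇒≢ b<m ∘ sym))) t) (V<m , inV)
      ; stackTop = subst (NotTop other) (sym here)
          (Top-disjoint (inBin offline m ∷ʳ trial) next≢other (topColor-∷ʳ (inBin offline m) trial))
      ; stackLevel = subst (λ is → sumSizes is ℚ.+ r · s ≤ 1ℚ) (sym here)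
          (subst (λ p → p ℚ.+ r · s ≤ 1ℚ) (sym (sumSizes-∷ʳ (inBin offline m) trial)) level)
      }

  step : ∀ {r u U} → Game (suc r) (u ∷ U) → Game (suc r) U ⊎ Game r (u ∷ U)
  step G with s , lo<s , s<hi ← ℚ.<-dense (Game.lo<hi G)
    with Game.hi G ℚ.≤? sumSizes (contents (Game.L G) (A (Game.L G) (trial G lo<s s<hi)))
  ... | yes placedHeavy = inj₁ (small G lo<s s<hi placedHeavy)
  ... | no placedLight  = inj₂ (large G lo<s s<hi placedLight)

  -- Every trial uses up either one of the `r` large items still missing from `K` or one bin of `U`,
  -- so the game ends.
  play : ∀ r U → Game r U → Outcome
  -- There are `K` heavy bins, which reject huge items of every color.
  play zero U G = finish G (λ {is} → Heavy-nonempty G {is})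
    (All.++⁺ (All.replicate⁺ (length V) (huge-floods-Heavy G a))
             (All.replicate⁺ (length U) (huge-floods-Heavy G next)))
    (subst (AtLeast (Heavy hi) L) (trans (sym (ℕ.+-identityʳ l)) l+r≡K) heavy)
    where open Game G
  -- With `U` empty all huge items have color `a`, so bins with top `a` reject them just as heavy
  -- ones do.
  play (suc r) [] G = finish G nonempty
    (All.++⁺ (All.replicate⁺ (length V) λ is → rejected is , inj₁ (topColor-∷ʳ is (huge G a))) [])
    blocked
    where
    open Game G
    nonempty : ∀ {is} → Top a is ⊎ Heavy hi is → is ≢ []
    nonempty (inj₁ ()) refl
    nonempty (inj₂ heavy)  = Heavy-nonempty G heavy
    rejected : ∀ is → ValidBin (is ∷ʳ huge G a) → ¬ (Top a is ⊎ Heavy hi is)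
    rejected is v (inj₁ ≡a)    = proj₂ (ValidBin-∷ʳ⁻ is v) ≡a
    rejected is v (inj₂ heavy) = huge-rejected G v heavy
  play (suc r) (u ∷ U) G = Sum.[ play (suc r) U , play r (u ∷ U) ]′ (step G)

module _ {k : ℕ} (A : OnlineAlg k) (valid : ValidAlg A) (n : ℕ) where
  open Phases A valid n

  endgame : ∀ {j D} (S : Stage j D) →
            Σ (List (Item k)) λ L → Packing L (suc (j + n)) × Stage.N S + n ≤ℕ ALG A L
  -- The initial `hi` is so small that `N` large items together fit into the auxiliary bin.
  endgame {j} S with h , 0<h , h≤½ , N·h≤½ ← fraction (Stage.N S) (ℚ.positive⁻¹ ½) =
    play N (upTo n) record
      { L = L ; lo = 0ℚ ; hi = h ; 0≤lo = ℚ.≤-refl ; lo<hi = 0<h ; hi≤½ = h≤½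
      ; next = b ; other = c ; a≢next = a≢b ; a≢other = a≢c ; next≢other = b≢c
      ; l = 0 ; l+r≡K = refl
      ; heavy = distinctBins [] [] [] refl
      ; blocked = transport (λ _ → inj₁) online
      ; V = [] ; sizes = length-upTo n ; uniqueU = Unique.upTo⁺ n ; uniqueV = []
      ; disjoint = All.universal (λ _ → []) (upTo n) ; U<m = upTo-bounded j n ; V<m = []
      ; offline = addBin offline ; inU = tops ; inV = []
      ; stackTop = subst (NotTop b) (sym (inBin-fresh offline)) (λ ())
      ; stackLevel = subst (λ is → sumSizes is ℚ.+ N · h ≤ 1ℚ) (sym (inBin-fresh offline))
          (subst (_≤ 1ℚ) (sym (ℚ.+-identityˡ (N · h)))
            (ℚ.≤-trans N·h≤½ ½≤1))
      }
    where
    open Stage S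
    open Endgame A valid (j + n) n N a
    open Online A valid

-- From the asymptotic bound to an inequality of natural numbers.

toℚᵘ-toℚ : ∀ n → ℚ.toℚᵘ (toℚ n) ℚᵘ.≃ mkℚᵘ (+ n) 0
toℚᵘ-toℚ n = ℚ.toℚᵘ-fromℚᵘ (mkℚᵘ (+ n) 0)

toℚ-+ : ∀ m n → toℚ (m + n) ≡ toℚ m ℚ.+ toℚ n
toℚ-+ m n = ℚ.toℚᵘ-injective (begin
  ℚ.toℚᵘ (toℚ (m + n))                      ≈⟨ toℚᵘ-toℚ (m + n) ⟩
  mkℚᵘ (+ (m + n)) 0                        ≈⟨ ℚᵘ.*≡* (cong (ℤ._* + 1)
                                                  (sym (cong₂ ℤ._+_ (ℤ.*-identityʳ (+ m)) (ℤ.*-identityʳ (+ n))))) ⟩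
  mkℚᵘ (+ m) 0 ℚᵘ.+ mkℚᵘ (+ n) 0            ≈⟨ ℚᵘ.+-cong (toℚᵘ-toℚ m) (toℚᵘ-toℚ n) ⟨
  ℚ.toℚᵘ (toℚ m) ℚᵘ.+ ℚ.toℚᵘ (toℚ n)        ≈⟨ ℚ.toℚᵘ-homo-+ (toℚ m) (toℚ n) ⟨
  ℚ.toℚᵘ (toℚ m ℚ.+ toℚ n)                  ∎)
  where open ℚᵘ.≃-Reasoning

toℚ-* : ∀ m n → toℚ (m * n) ≡ toℚ m ℚ.* toℚ n
toℚ-* m n = ℚ.toℚᵘ-injective (begin
  ℚ.toℚᵘ (toℚ (m * n))                      ≈⟨ toℚᵘ-toℚ (m * n) ⟩
  mkℚᵘ (+ (m * n)) 0                        ≈⟨ ℚᵘ.*≡* (cong (ℤ._* + 1) (ℤ.pos-* m n)) ⟩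
  mkℚᵘ (+ m) 0 ℚᵘ.* mkℚᵘ (+ n) 0            ≈⟨ ℚᵘ.*-cong (toℚᵘ-toℚ m) (toℚᵘ-toℚ n) ⟨
  ℚ.toℚᵘ (toℚ m) ℚᵘ.* ℚ.toℚᵘ (toℚ n)        ≈⟨ ℚ.toℚᵘ-homo-* (toℚ m) (toℚ n) ⟨
  ℚ.toℚᵘ (toℚ m ℚ.* toℚ n)                  ∎)
  where open ℚᵘ.≃-Reasoning

toℚ-cancel-≤ : ∀ {m n} → toℚ m ≤ toℚ n → m ≤ℕ n
toℚ-cancel-≤ {m} {n} m≤n with ℚᵘ.≤-respˡ-≃ (toℚᵘ-toℚ m) (ℚᵘ.≤-respʳ-≃ (toℚᵘ-toℚ n) (ℚ.toℚᵘ-mono-≤ m≤n))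
... | ℚᵘ.*≤* m*1≤n*1 = ℤ.drop‿+≤+ (ℤ.*-cancelʳ-≤-pos (+ m) (+ n) (+ 1) m*1≤n*1)

toℚ-mono-≤ : ∀ {m n} → m ≤ℕ n → toℚ m ≤ toℚ n
toℚ-mono-≤ {m} {n} m≤n = ℚ.toℚᵘ-cancel-≤
  (ℚᵘ.≤-respˡ-≃ (ℚᵘ.≃-sym (toℚᵘ-toℚ m)) (ℚᵘ.≤-respʳ-≃ (ℚᵘ.≃-sym (toℚᵘ-toℚ n))
    (ℚᵘ.*≤* (ℤ.*-monoʳ-≤-nonNeg (+ 1) (ℤ.+≤+ m≤n)))))

archimedean : ∀ p → ∃ λ C → p ≤ toℚ C
archimedean p@(ℚ.mkℚ n d _) = ℤ.∣ n ∣ , ℚ.toℚᵘ-cancel-≤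
  (ℚᵘ.≤-respʳ-≃ (ℚᵘ.≃-sym (toℚᵘ-toℚ ℤ.∣ n ∣)) (ℚᵘ.*≤* (numerator n)))
  where
  numerator : ∀ n → n ℤ.* + 1 ℤ.≤ + ℤ.∣ n ∣ ℤ.* + suc d
  numerator (+ n)    = ℤ.*-monoˡ-≤-nonNeg (+ n) (ℤ.+≤+ (s≤s z≤n))
  numerator -[1+ n ] = ℤ.-≤+

reciprocal : ∀ {ε} → 0ℚ < ε → ∃ λ q → 1ℚ ≤ toℚ (suc q) ℚ.* ε
reciprocal {ε} 0<ε = q , subst (_≤ toℚ (suc q) ℚ.* ε) (ℚ.*-inverseˡ ε)
  (ℚ.*-monoʳ-≤-nonNeg ε (ℚ.≤-trans (proj₂ (archimedean (ℚ.1/ ε))) (toℚ-mono-≤ (ℕ.n≤1+n q))))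
  where
  instance
    pos : ℚ.Positive ε
    pos = ℚ.positive 0<ε
    nonZero : ℚ.NonZero ε
    nonZero = ℚ.pos⇒nonZero ε
    nonNeg : ℚ.NonNegative ε
    nonNeg = ℚ.pos⇒nonNeg ε
  q = proj₁ (archimedean (ℚ.1/ ε))

bounded-< : ∀ (f : ℕ → ℚ) N → ∃ λ C → ∀ m → m <ℕ N → f m ≤ toℚ C
bounded-< f zero    = 0 , λ _ ()
bounded-< f (suc N) with C , f≤C ← bounded-< f N | C′ , fN≤C′ ← archimedean (f N) = C ⊔ C′ , bound
  where
  bound : ∀ m → m <ℕ suc N → f m ≤ toℚ (C ⊔ C′)
  bound m m<1+N with ℕ.m<1+n⇒m<n∨m≡n m<1+N
  ... | inj₁ m<N  = ℚ.≤-trans (f≤C m m<N) (toℚ-mono-≤ (ℕ.m≤m⊔n C C′))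
  ... | inj₂ refl = ℚ.≤-trans fN≤C′ (toℚ-mono-≤ (ℕ.m≤n⊔m C C′))

-- The constant absorbs the finitely many values before the threshold. The bound must hold for every
-- `m`, since the adversary controls the optimum only from above.
LittleO-bound : ∀ {f} → LittleO f → ∀ {ε} → 0ℚ < ε → ∃ λ C → ∀ m → f m ≤ toℚ C ℚ.+ ε ℚ.* toℚ m
LittleO-bound {f} o {ε} 0<ε with N , large ← o ε 0<ε with C , small ← bounded-< f N = C , bound
  where
  0≤ε*m : ∀ m → 0ℚ ≤ ε ℚ.* toℚ m
  0≤ε*m m = subst (_≤ ε ℚ.* toℚ m) (ℚ.*-zeroʳ ε)
    (ℚ.*-monoˡ-≤-nonNeg ε {{ℚ.pos⇒nonNeg ε {{ℚ.positive 0<ε}}}} (toℚ-mono-≤ {0} {m} z≤n))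
  f≤∣f∣ : ∀ p → p ≤ ℚ.∣ p ∣
  f≤∣f∣ p with ℚ.≤-total 0ℚ p
  ... | inj₁ 0≤p = ℚ.≤-reflexive (sym (ℚ.0≤p⇒∣p∣≡p 0≤p))
  ... | inj₂ p≤0 = ℚ.≤-trans p≤0 (ℚ.0≤∣p∣ p)
  bound : ∀ m → f m ≤ toℚ C ℚ.+ ε ℚ.* toℚ m
  bound m with m ℕ.<? N
  ... | yes m<N = ℚ.≤-trans (small m m<N) (p≤p+q (0≤ε*m m))
  ... | no m≮N  = ℚ.≤-trans (f≤∣f∣ (f m)) (ℚ.≤-trans (large m (ℕ.≮⇒≥ m≮N)) (p≤q+p (toℚ-mono-≤ {0} {C} z≤n)))

-- Adding ε m to both sides turns the slope r + ε into h. Multiplying by 2Q then eliminates ε,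
-- because Q ε is at least 1.
scaledBound : ∀ {r ε h a m C} Q → 0ℚ ≤ Q → 0ℚ ≤ m → r ℚ.+ (ε ℚ.+ ε) ≡ h → 1ℚ ≤ Q ℚ.* ε →
              a ≤ r ℚ.* m ℚ.+ (C ℚ.+ ε ℚ.* m) →
              (Q ℚ.* a ℚ.+ Q ℚ.* a) ℚ.+ (m ℚ.+ m) ≤ Q ℚ.* ((h ℚ.+ h) ℚ.* m) ℚ.+ (Q ℚ.* C ℚ.+ Q ℚ.* C)
scaledBound {r} {ε} {h} {a} {m} {C} Q 0≤Q 0≤m refl 1≤Qε a≤ = begin
  (Q ℚ.* a ℚ.+ Q ℚ.* a) ℚ.+ (m ℚ.+ m)
    ≤⟨ ℚ.+-monoʳ-≤ (Q ℚ.* a ℚ.+ Q ℚ.* a) (ℚ.+-mono-≤ m≤Qεm m≤Qεm) ⟩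
  (Q ℚ.* a ℚ.+ Q ℚ.* a) ℚ.+ (Q ℚ.* ε ℚ.* m ℚ.+ Q ℚ.* ε ℚ.* m)
    ≡⟨ solve 4 (λ Q a ε m → (Q :* a :+ Q :* a) :+ (Q :* ε :* m :+ Q :* ε :* m) :=
                 Q :* ((a :+ ε :* m) :+ (a :+ ε :* m))) refl Q a ε m ⟩
  Q ℚ.* ((a ℚ.+ ε ℚ.* m) ℚ.+ (a ℚ.+ ε ℚ.* m))
    ≤⟨ ℚ.*-monoˡ-≤-nonNeg Q {{ℚ.nonNegative 0≤Q}} (ℚ.+-mono-≤ step step) ⟩
  Q ℚ.* ((r ℚ.* m ℚ.+ (C ℚ.+ ε ℚ.* m) ℚ.+ ε ℚ.* m) ℚ.+ (r ℚ.* m ℚ.+ (C ℚ.+ ε ℚ.* m) ℚ.+ ε ℚ.* m))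
    ≡⟨ solve 5 (λ Q r m C ε →
         Q :* ((r :* m :+ (C :+ ε :* m) :+ ε :* m) :+ (r :* m :+ (C :+ ε :* m) :+ ε :* m)) :=
         Q :* (((r :+ (ε :+ ε)) :+ (r :+ (ε :+ ε))) :* m) :+ (Q :* C :+ Q :* C)) refl Q r m C ε ⟩
  Q ℚ.* ((h ℚ.+ h) ℚ.* m) ℚ.+ (Q ℚ.* C ℚ.+ Q ℚ.* C) ∎
  where
  open ℚ.≤-Reasoning
  open ℚ.+-*-Solver
  m≤Qεm : m ≤ Q ℚ.* ε ℚ.* m
  m≤Qεm = subst (_≤ Q ℚ.* ε ℚ.* m) (ℚ.*-identityˡ m) (ℚ.*-monoʳ-≤-nonNeg m {{ℚ.nonNegative 0≤m}} 1≤Qε)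
  step : a ℚ.+ ε ℚ.* m ≤ r ℚ.* m ℚ.+ (C ℚ.+ ε ℚ.* m) ℚ.+ ε ℚ.* m
  step = ℚ.+-monoˡ-≤ (ε ℚ.* m) a≤

integerBound : ∀ {r ε} q a m C → r ℚ.+ (ε ℚ.+ ε) ≡ + 5 / 2 → 1ℚ ≤ toℚ q ℚ.* ε →
               toℚ a ≤ r ℚ.* toℚ m ℚ.+ (toℚ C ℚ.+ ε ℚ.* toℚ m) →
               (q * a + q * a) + (m + m) ≤ℕ q * (5 * m) + (q * C + q * C)
integerBound {r} {ε} q a m C r+2ε≡5/2 1≤qε a≤ = toℚ-cancel-≤ (subst (_≤ _) (sym lhs) (subst (_ ≤_) (sym rhs)
  (scaledBound {r} {ε} (toℚ q) (toℚ-mono-≤ {0} {q} z≤n) (toℚ-mono-≤ {0} {m} z≤n) r+2ε≡5/2 1≤qε a≤)))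
  where
  twice : ∀ n → toℚ (q * n + q * n) ≡ toℚ q ℚ.* toℚ n ℚ.+ toℚ q ℚ.* toℚ n
  twice n = trans (toℚ-+ (q * n) (q * n)) (cong₂ ℚ._+_ (toℚ-* q n) (toℚ-* q n))
  lhs : toℚ ((q * a + q * a) + (m + m)) ≡ (toℚ q ℚ.* toℚ a ℚ.+ toℚ q ℚ.* toℚ a) ℚ.+ (toℚ m ℚ.+ toℚ m)
  lhs = trans (toℚ-+ (q * a + q * a) (m + m)) (cong₂ ℚ._+_ (twice a) (toℚ-+ m m))
  rhs : toℚ (q * (5 * m) + (q * C + q * C)) ≡
        toℚ q ℚ.* ((+ 5 / 2 ℚ.+ + 5 / 2) ℚ.* toℚ m) ℚ.+ (toℚ q ℚ.* toℚ C ℚ.+ toℚ q ℚ.* toℚ C)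
  rhs = trans (toℚ-+ (q * (5 * m)) (q * C + q * C))
    (cong₂ ℚ._+_ (trans (toℚ-* q (5 * m)) (cong (toℚ q ℚ.*_) (toℚ-* 5 m))) (twice C))

-- The contradiction.

n≤2^n : ∀ n → n ≤ℕ 2 ^ n
n≤2^n zero    = z≤n
n≤2^n (suc n) = ℕ.+-mono-≤ (ℕ.m^n>0 2 n) (ℕ.≤-trans (n≤2^n n) (ℕ.m≤m+n (2 ^ n) 0))

-- s exceeds what q times the additive constants C and u can make up for.
contradictory : ∀ q′ a m n C u → let q = suc q′; s = 5 * suc u + 2 * C in
                (q * a + q * a) + (m + m) ≤ℕ q * (5 * m) + (q * C + q * C) →
                5 * n ≤ℕ 2 * a + s → m ≤ℕ suc u + n → q * s ≤ℕ n → ⊥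
contradictory q′ a m n C u h₁ h₂ h₃ h₄ = ℕ.m+1+n≰m X (begin
  X + suc (suc (u + u))                                  ≡⟨ e₁ q′ C u n ⟩
  q * s + (5 * q′ + 3) * n + n                             ≤⟨ ℕ.+-monoˡ-≤ n (ℕ.+-monoˡ-≤ ((5 * q′ + 3) * n) h₄) ⟩
  n + (5 * q′ + 3) * n + n                                 ≡⟨ e₂ q′ n ⟩
  q * (5 * n)                                            ≤⟨ ℕ.*-monoʳ-≤ q h₂ ⟩
  q * (2 * a + s)                                        ≡⟨ e₃ q a s ⟩
  (q * a + q * a) + q * s                                ≤⟨ ℕ.+-mono-≤ h₅ h₄ ⟩
  ((5 * q′ + 3) * (suc u + n) + (q * C + q * C)) + n     ≡⟨ e₄ q′ u n C ⟩
  X                                                      ∎)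
  where
  open ℕ.≤-Reasoning
  q = suc q′
  s = 5 * suc u + 2 * C
  X = (5 * q′ + 3) * suc u + (5 * q′ + 3) * n + (q * C + q * C) + n
  e₁ : ∀ q′ C u n → (5 * q′ + 3) * suc u + (5 * q′ + 3) * n + (suc q′ * C + suc q′ * C) + n + suc (suc (u + u)) ≡
       suc q′ * (5 * suc u + 2 * C) + (5 * q′ + 3) * n + n
  e₁ = solve-∀
  e₂ : ∀ q′ n → n + (5 * q′ + 3) * n + n ≡ suc q′ * (5 * n)
  e₂ = solve-∀
  e₃ : ∀ q a s → q * (2 * a + s) ≡ (q * a + q * a) + q * s
  e₃ = solve-∀
  e₄ : ∀ q′ u n C → ((5 * q′ + 3) * (suc u + n) + (suc q′ * C + suc q′ * C)) + n ≡
       (5 * q′ + 3) * suc u + (5 * q′ + 3) * n + (suc q′ * C + suc q′ * C) + n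
  e₄ = solve-∀
  e₅ : ∀ q′ m C → suc q′ * (5 * m) + (suc q′ * C + suc q′ * C) ≡
       (5 * q′ + 3) * m + (suc q′ * C + suc q′ * C) + (m + m)
  e₅ = solve-∀
  -- Cancelling 2m leaves m the coefficient 5q - 2 = 5q′ + 3, which is positive, so the upper bound
  -- for m applies.
  h₅ : q * a + q * a ≤ℕ (5 * q′ + 3) * (suc u + n) + (q * C + q * C)
  h₅ = ℕ.≤-trans (ℕ.+-cancelʳ-≤ (m + m) _ _ (ℕ.≤-trans h₁ (ℕ.≤-reflexive (e₅ q′ m C))))
    (ℕ.+-monoˡ-≤ (q * C + q * C) (ℕ.*-monoʳ-≤ (5 * q′ + 3) h₃))

-- If `M` is not minimal, well-founded induction descends to a smaller packable number. The double
-- negation avoids deciding `Packable` and suffices for a negative goal.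
¬¬IsOPT : ∀ {k} (L : List (Item k)) M → Packable L M → ¬ ¬ (∃ λ m → m ≤ℕ M × IsOPT L m)
¬¬IsOPT L = <-rec _ λ M rec packable none →
  none (M , ℕ.≤-refl , packable , minimal rec none)
  where
  minimal : ∀ {M} → (∀ {m} → m <ℕ M → Packable L m → ¬ ¬ (∃ λ m′ → m′ ≤ℕ m × IsOPT L m′)) →
            ¬ (∃ λ m → m ≤ℕ M × IsOPT L m) → ∀ m → Packable L m → M ≤ℕ m
  minimal {M} rec none m packable with M ℕ.≤? m
  ... | yes M≤m = M≤m
  ... | no M≰m  = ⊥-elim (rec (ℕ.≰⇒> M≰m) packable
    λ (m′ , m′≤m , opt) → none (m′ , ℕ.≤-trans m′≤m (ℕ.<⇒≤ (ℕ.≰⇒> M≰m)) , opt))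

endgameBound : ∀ {k} (A : OnlineAlg k) (valid : ValidAlg A) n {j s} → Phases.Stage A valid n j s →
               ∃ λ L → Packing L (suc j + n) × 5 * n ≤ℕ 2 * ALG A L + s
endgameBound A valid n {s = s} S with L , P , N+n≤ALG ← endgame A valid n S = L , P , (begin
  5 * n                ≡⟨ e₁ n ⟩
  3 * n + 2 * n        ≤⟨ ℕ.+-monoˡ-≤ (2 * n) bound ⟩
  2 * N + s + 2 * n    ≡⟨ e₂ N s n ⟩
  2 * (N + n) + s      ≤⟨ ℕ.+-monoˡ-≤ s (ℕ.*-monoʳ-≤ 2 N+n≤ALG) ⟩
  2 * ALG A L + s      ∎)
  where
  open ℕ.≤-Reasoning
  open Phases.Stage S using (N; bound)
  e₁ : ∀ n → 5 * n ≡ 3 * n + 2 * n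
  e₁ = solve-∀
  e₂ : ∀ N s n → 2 * N + s + 2 * n ≡ 2 * (N + n) + s
  e₂ = solve-∀

-- The initial defect `n` is `2 ^ t * s`, and `t` halvings reduce it to `s`. Each phase and the
-- endgame add one offline bin.
lowerBound : ∀ {k} (A : OnlineAlg k) → ValidAlg A → ∀ {a b c : Fin k} → a ≢ b → a ≢ c → b ≢ c → ∀ t s →
             let n = 2 ^ t * s in
             ∃ λ L → Packing L (suc t + n) × 5 * n ≤ℕ 2 * ALG A L + s
lowerBound A valid a≢b a≢c b≢c t s = endgameBound A valid n
  (subst (λ j → Stage j s) (ℕ.+-identityʳ t) (phases t (start a≢b a≢c b≢c)))
  where
  n = 2 ^ t * s
  open Phases A valid n

halfGap : ∀ {p r} → r < p → ∃ λ ε → 0ℚ < ε × r ℚ.+ (ε ℚ.+ ε) ≡ p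
halfGap {p} {r} r<p = ½ ℚ.* (p ℚ.- r) , ½-positive 0<p-r ,
  trans (cong (r ℚ.+_) (½+½ (p ℚ.- r))) (solve 2 (λ p r → r :+ (p :- r) := p) refl p r)
  where
  open ℚ.+-*-Solver
  0<p-r : 0ℚ < p ℚ.- r
  0<p-r = subst (_< p ℚ.- r) (ℚ.+-inverseʳ r) (ℚ.+-monoˡ-< (ℚ.- r) r<p)

refutation : ∀ {k} (A : OnlineAlg k) {r ε} {f : ℕ → ℚ} {q C} → r ℚ.+ (ε ℚ.+ ε) ≡ + 5 / 2 → 1ℚ ≤ toℚ (suc q) ℚ.* ε →
  (∀ m → f m ≤ toℚ C ℚ.+ ε ℚ.* toℚ m) → (∀ L m → IsOPT L m → toℚ (ALG A L) ≤ r ℚ.* toℚ m ℚ.+ f m) →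
  ∀ {n} → suc q * (5 * suc (suc q) + 2 * C) ≤ℕ n →
  ¬ ∃ λ L → Packing L (suc (suc q) + n) × 5 * n ≤ℕ 2 * ALG A L + (5 * suc (suc q) + 2 * C)
refutation A {r} {ε} {q = q} {C} r+2ε≡5/2 1≤qε f≤ competitive {n} q*s≤n (L , P , 5n≤) =
  ¬¬IsOPT L _ (toPackable P) λ (m , m≤M , opt) →
    contradictory q (ALG A L) m n C (suc q)
      (integerBound {r} {ε} (suc q) (ALG A L) m C r+2ε≡5/2 1≤qε
        (ℚ.≤-trans (competitive L m opt) (ℚ.+-monoʳ-≤ (r ℚ.* toℚ m) (f≤ m))))
      5n≤ m≤M q*s≤n

theorem4p1 : (k : ℕ) → 3 ≤ℕ k → (A : OnlineAlg k) → ValidAlg A →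
    (r : ℚ) → r < + 5 / 2 → ¬ AsymptoticallyCompetitive A r
theorem4p1 (suc (suc (suc k))) (s≤s (s≤s (s≤s _))) A valid r r<5/2 (f , o , competitive) =
  let ε , 0<ε , r+2ε≡5/2 = halfGap r<5/2
      q , 1≤qε           = reciprocal 0<ε
      C , f≤             = LittleO-bound o 0<ε
      -- Here `suc (suc q)` counts the auxiliary bins of `suc q` phases and the endgame. That many
      -- phases give n = 2 ^ (q + 1) * s, which is at least (q + 1) * s.
      s                  = 5 * suc (suc q) + 2 * C
  in refutation A {r} {ε} {f} {q} {C} r+2ε≡5/2 1≤qε f≤ competitive
       (ℕ.*-monoˡ-≤ s (n≤2^n (suc q)))
       (lowerBound A valid {Fin.zero} {Fin.suc Fin.zero} {Fin.suc (Fin.suc Fin.zero)}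
         (λ ()) (λ ()) (λ ()) (suc q) s)
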